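{- Let $r\geq 3$ and let $G$ be a connected $(P_4,K_{1,r})$-free graph with at least $3$ vertices. Then $rx_3(G)\leq sdiam_3(G)+r+3$.
   Context: All graphs are finite, simple, undirected. A tree in an edge-colored graph is rainbow if no two of its edges have the same color; an $S$-tree is a tree containing all vertices of $S$. A $3$-rainbow coloring of a connected graph $G$ is an edge-coloring (adjacent edges may share colors) such that every $3$-element vertex set $S$ has a rainbow $S$-tree; $rx_3(G)$ is the minimum number of colors in such a coloring. $sdiam_3(G)$ is the maximum, over all $3$-element $S\subseteq V(G)$, of the minimum number of edges of an $S$-tree. $(P_4,K_{1,r})$-free means no induced subgraph isomorphic to the path $P_4$ on $4$ vertices or to the star $K_{1,r}$. -}

module Defs where

open import Data.Bool.Base using (Bool; true; false; T; _∨_)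
open import Data.Bool.Properties using (∨-comm; T?)
open import Data.Fin.Base using (Fin; zero; suc; toℕ; fromℕ; inject₁)
open import Data.Fin.Properties using (_<?_)
open import Data.Fin.Subset using (Subset; _∈_; _⊆_; ∣_∣; Nonempty)
open import Data.List.Base using (List; allFin; cartesianProduct; filter; length)
open import Data.Nat.Base using (ℕ; zero; suc; _+_; _≤_; _≡ᵇ_)
open import Data.Product.Base using (Σ; _×_; _,_)
open import Data.Sum.Base using (_⊎_)
open import Function.Bundles using (_⇔_)
open import Function.Definitions using (Injective)
open import Relation.Binary.Construct.Closure.ReflexiveTransitive using (Star)
open import Relation.Binary.PropositionalEquality using (_≡_; refl; cong₂)
open import Relation.Nullary using (¬_)
open import Relation.Nullary.Decidable using (_×-dec_)

record Graph (n : ℕ) : Set where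
  field
    adj        : Fin n → Fin n → Bool
    adj-sym    : ∀ u v → adj u v ≡ adj v u
    adj-irrefl : ∀ v → adj v v ≡ false

  Adj : Fin n → Fin n → Set
  Adj u v = T (adj u v)

open Graph public using (Adj)

-- Each edge is listed once, as the ordered pair with u < v.
edgeList : ∀ {n} → Graph n → List (Fin n × Fin n)
edgeList {n} G =
  filter (λ (u , v) → (u <? v) ×-dec T? (Graph.adj G u v))
         (cartesianProduct (allFin n) (allFin n))

numEdges : ∀ {n} → Graph n → ℕ
numEdges G = length (edgeList G)

Connected : ∀ {n} → Graph n → Set
Connected G = ∀ u v → Star (Adj G) u v

-- A cycle f 0, f 1, …, f (m + 2) through m + 3 distinct vertices.
record Cycle {n : ℕ} (G : Graph n) : Set where
  field
    m         : ℕ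
    f         : Fin (3 + m) → Fin n
    injective : Injective _≡_ _≡_ f
    step      : ∀ (i : Fin (2 + m)) → Adj G (f (inject₁ i)) (f (suc i))
    close     : Adj G (f (fromℕ (2 + m))) (f zero)

Acyclic : ∀ {n} → Graph n → Set
Acyclic G = ¬ Cycle G

-- The edge set of a subgraph is given as a graph on all of Fin n in which the
-- vertices outside verts are isolated.
record Subgraph {n : ℕ} (G : Graph n) : Set where
  field
    verts     : Subset n
    edges     : Graph n
    edges⊆G   : ∀ u v → Adj edges u v → Adj G u v
    endpoints : ∀ u v → Adj edges u v → u ∈ verts × v ∈ verts

record IsTree {n : ℕ} {G : Graph n} (H : Subgraph G) : Set where
  open Subgraph H
  field
    nonempty  : Nonempty verts
    connected : ∀ u v → u ∈ verts → v ∈ verts → Star (Adj edges) u v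
    acyclic   : Acyclic edges

IsSTree : ∀ {n} {G : Graph n} → Subset n → Subgraph G → Set
IsSTree S H = IsTree H × S ⊆ Subgraph.verts H

-- The symmetry law also makes the colour independent of the adjacency proof.
record EdgeColoring {n : ℕ} (G : Graph n) (k : ℕ) : Set where
  field
    color     : ∀ u v → Adj G u v → Fin k
    color-sym : ∀ u v (p : Adj G u v) (q : Adj G v u) → color u v p ≡ color v u q

Rainbow : ∀ {n k} {G : Graph n} → EdgeColoring G k → Subgraph G → Set
Rainbow c H =
  ∀ u v u′ v′ (p : Adj edges u v) (p′ : Adj edges u′ v′) →
  color u v (edges⊆G u v p) ≡ color u′ v′ (edges⊆G u′ v′ p′) →
  (u ≡ u′ × v ≡ v′) ⊎ (u ≡ v′ × v ≡ u′)
  where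
  open Subgraph H
  open EdgeColoring c

Is3RainbowColoring : ∀ {n k} (G : Graph n) → EdgeColoring G k → Set
Is3RainbowColoring {n} G c =
  ∀ (S : Subset n) → ∣ S ∣ ≡ 3 → Σ (Subgraph G) λ H → IsSTree S H × Rainbow c H

IsMinimum : (ℕ → Set) → ℕ → Set
IsMinimum P k = P k × (∀ j → P j → k ≤ j)

IsMaximum : (ℕ → Set) → ℕ → Set
IsMaximum P k = P k × (∀ j → P j → j ≤ k)

-- IsRx₃ G k expresses rx₃(G) = k.
IsRx₃ : ∀ {n} → Graph n → ℕ → Set
IsRx₃ G = IsMinimum λ k → Σ (EdgeColoring G k) (Is3RainbowColoring G)

IsSteinerDistance : ∀ {n} → Graph n → Subset n → ℕ → Set
IsSteinerDistance G S =
  IsMinimum λ m → Σ (Subgraph G) λ H → IsSTree S H × numEdges (Subgraph.edges H) ≡ m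

-- IsSdiam₃ G d expresses sdiam₃(G) = d.
IsSdiam₃ : ∀ {n} → Graph n → ℕ → Set
IsSdiam₃ {n} G =
  IsMaximum λ m → Σ (Subset n) λ S → ∣ S ∣ ≡ 3 × IsSteinerDistance G S m

record InducedCopy {m n : ℕ} (H : Graph m) (G : Graph n) : Set where
  field
    f         : Fin m → Fin n
    injective : Injective _≡_ _≡_ f
    induced   : ∀ i j → Adj H i j ⇔ Adj G (f i) (f j)

_-Free_ : ∀ {m n} → Graph m → Graph n → Set
H -Free G = ¬ InducedCopy H G

private
  1+n≢ᵇn : ∀ n → (suc n ≡ᵇ n) ≡ false
  1+n≢ᵇn zero    = refl
  1+n≢ᵇn (suc n) = 1+n≢ᵇn n

-- The path on n vertices.
Path : (n : ℕ) → Graph n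
Path n = record
  { adj        = λ i j → (suc (toℕ i) ≡ᵇ toℕ j) ∨ (suc (toℕ j) ≡ᵇ toℕ i)
  ; adj-sym    = λ i j → ∨-comm (suc (toℕ i) ≡ᵇ toℕ j) (suc (toℕ j) ≡ᵇ toℕ i)
  ; adj-irrefl = λ i → cong₂ _∨_ (1+n≢ᵇn (toℕ i)) (1+n≢ᵇn (toℕ i))
  }

-- K_{1,r} with centre zero.
K₁ : (r : ℕ) → Graph (suc r)
K₁ r = record { adj = adj ; adj-sym = adj-sym ; adj-irrefl = adj-irrefl }
  where
  adj : Fin (suc r) → Fin (suc r) → Bool
  adj zero    zero    = false
  adj zero    (suc _) = true
  adj (suc _) zero    = true
  adj (suc _) (suc _) = false

  adj-sym : ∀ i j → adj i j ≡ adj j i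
  adj-sym zero    zero    = refl
  adj-sym zero    (suc _) = refl
  adj-sym (suc _) zero    = refl
  adj-sym (suc _) (suc _) = refl

  adj-irrefl : ∀ i → adj i i ≡ false
  adj-irrefl zero    = refl
  adj-irrefl (suc _) = refl

{-# OPTIONS --safe #-}
-- Since sdiam₃ ≥ 2, it suffices to use at most r + 5 colours. A connected P₄-free
-- graph is a join of two non-empty sides A and B. If a core is connected by
-- rainbow trees and every other vertex has three legs into it, of three further
-- colours, then all triples are connected: each vertex takes its own leg.
-- If |A|, |B| ≥ 3, the core consists of three vertices of either side.
-- Otherwise |A| ≤ 2, say. Fix a ∈ A and an independent set I ⊆ B which can be
-- enlarged neither by adding a vertex nor by exchanging one vertex for two;
-- |I| < r because a is adjacent to all of I. A vertex of B ∖ I then has two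
-- neighbours in I, or is a private neighbour of one i ∈ I, and the private
-- neighbours of i form a clique. Pairing each i with one of its private
-- neighbours gives a core {a} ∪ I ∪ {partners} in which every other vertex of B
-- has three neighbours: a and two hubs.
module Submission where

open import Data.Bool.Base using (Bool; true; false; T; not; _∧_)
open import Data.Bool.Properties using (not-involutive; ¬-not) renaming (_≟_ to _B≟_)
open import Data.Empty using (⊥; ⊥-elim)
open import Data.Fin.Base using (Fin; zero; suc; fromℕ; inject₁; _↑ˡ_; _↑ʳ_)
open import Data.Fin.Patterns using (0F; 1F; 2F; 3F; 4F)
open import Data.Fin.Properties using (_≟_; any?; all?; suc-injective; <-cmp; ↑ˡ-injective; ↑ʳ-injective)
open import Data.Fin.Relation.Unary.Top using (view; ‵fromℕ; ‵inject₁)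
open import Data.Fin.Subset using (Subset; _∈_; _∉_; ∣_∣; ⁅_⁆; _∪_; inside; outside)
open import Data.Fin.Subset.Properties using (_∈?_; x∈⁅x⁆; x∈⁅y⁆⇒x≡y; x∈p∪q⁺; x∈p∪q⁻)
open import Data.List.Base using (List; []; _∷_; length)
open import Data.List.Membership.Propositional using () renaming (_∈_ to _∈ₗ_)
open import Data.List.Membership.Propositional.Properties using (∈-filter⁺; ∈-cartesianProduct⁺; ∈-allFin)
open import Data.List.Relation.Unary.All as All using (All; []; _∷_)
open import Data.List.Relation.Unary.Any using (here; there)
open import Data.Maybe.Base using (Maybe; just; nothing)
open import Data.Nat.Base using (ℕ; zero; suc; _+_; _≤_; _<_; s≤s)
open import Data.Nat.Properties as ℕₚ using ()
open import Data.Product.Base using (Σ; ∃; ∃₂; _×_; _,_; proj₁; proj₂)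
open import Data.Sum.Base using (_⊎_; inj₁; inj₂; [_,_]′; map)
open import Data.Vec.Base as Vec using ()
open import Function.Base using (_∘_; id; case_of_)
open import Function.Bundles using (_⇔_; mk⇔)
open import Function.Definitions using (Injective)
open import Relation.Binary.Construct.Closure.ReflexiveTransitive as Star using (Star; ε; _◅_; _◅◅_)
open import Relation.Binary.Definitions using (tri<; tri≈; tri>)
open import Relation.Binary.PropositionalEquality using (_≡_; _≢_; refl; sym; trans; cong; cong₂; subst)
open import Relation.Nullary using (¬_; Dec; yes; no; contradiction; does)
open import Relation.Nullary.Decidable using (_×-dec_; _⊎-dec_; _→-dec_; ¬?; T?; decidable-stable; does-⇔; dec-false)
open import Defs

-- Basic facts on adjacency.

module _ {n : ℕ} (G : Graph n) where

  Adj-sym : ∀ {u v} → Adj G u v → Adj G v u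
  Adj-sym {u} {v} = subst T (Graph.adj-sym G u v)

  Adj-irrefl : ∀ {v} → ¬ Adj G v v
  Adj-irrefl {v} = subst T (Graph.adj-irrefl G v)

  Adj⇒≢ : ∀ {u v} → Adj G u v → u ≢ v
  Adj⇒≢ p refl = Adj-irrefl p

  Adj? : ∀ u v → Dec (Adj G u v)
  Adj? u v = T? (Graph.adj G u v)

-- Joins and induced P₄
record InducedP₄ {m : ℕ} (e : Fin m → Fin m → Bool) : Set where
  field
    w x y z : Fin m
    wx : e w x ≡ true
    xy : e x y ≡ true
    yz : e y z ≡ true
    wy : e w y ≡ false
    xz : e x z ≡ false
    wz : e w z ≡ false

-- A join for `b = true`, a disconnection for `b = false`; with `b` as a parameter, complementation
-- exchanges the two.
record Split {m : ℕ} (e : Fin m → Fin m → Bool) (b : Bool) : Set where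
  field
    side   : Fin m → Bool
    left   : ∃ λ i → side i ≡ true
    right  : ∃ λ i → side i ≡ false
    across : ∀ i j → side i ≡ true → side j ≡ false → e i j ≡ b

Symm : ∀ {m} → (Fin m → Fin m → Bool) → Set
Symm e = ∀ i j → e i j ≡ e j i

not-≡ : ∀ {b c} → not b ≡ c → b ≡ not c
not-≡ {b} refl = sym (not-involutive b)

co : ∀ {m} → (Fin m → Fin m → Bool) → Fin m → Fin m → Bool
co e i j = not (e i j)

-- The path on four vertices is self-complementary: the non-edges of w-x-y-z form the path y-w-z-x.
co-P₄ : ∀ {m} {e : Fin m → Fin m → Bool} → Symm e → InducedP₄ (co e) → InducedP₄ e
co-P₄ s p = record
  { w = y ; x = w ; y = z ; z = x
  ; wx = trans (s y w) (not-≡ wy) ; xy = not-≡ wz ; yz = trans (s z x) (not-≡ xz)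
  ; wy = not-≡ yz ; xz = not-≡ wx ; wz = trans (s y x) (not-≡ xy) }
  where open InducedP₄ p

co-Split : ∀ {m} {e : Fin m → Fin m → Bool} {b} → Split (co e) b → Split e (not b)
co-Split s = record { Split s ; across = λ i j p q → not-≡ (Split.across s i j p q) }

swap-Split : ∀ {m} {e : Fin m → Fin m → Bool} {b} → Symm e → Split e b → Split e b
swap-Split es s = record
  { side = not ∘ side
  ; left = proj₁ right , cong not (proj₂ right)
  ; right = proj₁ left , cong not (proj₂ left)
  ; across = λ i j p q → trans (es i j) (across j i (not-≡ q) (not-≡ p)) }
  where open Split s

module _ {m : ℕ} (e : Fin (suc m) → Fin (suc m) → Bool) (es : Symm e) where

  private
    rest : Fin m → Fin m → Bool
    rest i j = e (suc i) (suc j)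

  uniform-Split : ∀ b → Fin m → (∀ i → e zero (suc i) ≡ b) → Split e b
  uniform-Split b i₀ h = record
    { side = λ { zero → true ; (suc _) → false }
    ; left = zero , refl
    ; right = suc i₀ , refl
    ; across = λ { zero zero _ () ; zero (suc j) _ _ → h j ; (suc _) _ () } }

  absorb-Split : (s : Split rest false) → (∀ i → Split.side s i ≡ true → e zero (suc i) ≡ false) →
                 Split e false
  absorb-Split s h = record
    { side = λ { zero → false ; (suc i) → side i }
    ; left = suc (proj₁ left) , proj₂ left
    ; right = zero , refl
    ; across = λ { zero _ () ; (suc i) zero p _ → trans (es (suc i) zero) (h i p)
                 ; (suc i) (suc j) → across i j } }
    where open Split s

  -- y is a non-neighbour of the new vertex on the left and w a neighbour on the
  -- right. If no edge joins the non-neighbours on the left to the neighbours on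
  -- the left, the former are cut off; such an edge completes an induced P₄.
  cut-or-P₄ : (s : Split rest false) → let open Split s in
    ∀ y → side y ≡ true → e zero (suc y) ≡ false →
    ∀ w → side w ≡ false → e zero (suc w) ≡ true →
    InducedP₄ e ⊎ Split e false
  cut-or-P₄ s y sy ey w sw ew
    with any? (λ u → any? (λ v → (side u B≟ true) ×-dec (e zero (suc u) B≟ false) ×-dec
                                  (side v B≟ true) ×-dec (e zero (suc v) B≟ true) ×-dec
                                  (e (suc u) (suc v) B≟ true)))
    where open Split s
  ... | yes (u , v , su , eu , sv , ev , uv) = inj₁ record
    { w = suc w ; x = zero ; y = suc v ; z = suc u
    ; wx = trans (es _ _) ew ; xy = ev ; yz = trans (es _ _) uv
    ; wy = trans (es _ _) (across v w sv sw) ; xz = eu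
    ; wz = trans (es _ _) (across u w su sw) }
    where open Split s
  ... | no none = inj₂ record
    { side = cut
    ; left = suc y , cut-y
    ; right = zero , refl
    ; across = cut-across }
    where
    open Split s
    cut : Fin (suc m) → Bool
    cut zero    = false
    cut (suc i) = side i ∧ not (e zero (suc i))

    cut-y : cut (suc y) ≡ true
    cut-y = cong₂ (λ b c → b ∧ not c) sy ey

    ∧-not-true : ∀ {b c} → b ∧ not c ≡ true → b ≡ true × c ≡ false
    ∧-not-true {true} {false} _ = refl , refl

    cut-across : ∀ i j → cut i ≡ true → cut j ≡ false → e i j ≡ false
    cut-across (suc i) zero p _ = trans (es _ _) (proj₂ (∧-not-true p))
    cut-across (suc i) (suc j) p q with ∧-not-true p | side j in sj | e zero (suc j) in ej | q
    ... | si , _  | false | _    | _ = across i j si sj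
    ... | si , ei | true  | true | _ = ¬-not λ eij → none (i , j , si , ei , sj , ej , eij)

  -- If the new vertex has no neighbour on one side, it moves to the other side. If it is adjacent
  -- to everything, it alone is one side of a join. Otherwise it has neighbours on both sides and
  -- some non-neighbour `y`, and `cut-or-P₄` applies with the side of `y` as the left one.
  extend-Split : (s : Split rest false) → InducedP₄ e ⊎ ∃ (Split e)
  extend-Split s with find-side true | find-side false
    where
    open Split s
    find-side : ∀ b → Dec (∃ λ i → side i ≡ b × e zero (suc i) ≡ true)
    find-side b = any? (λ i → (side i B≟ b) ×-dec (e zero (suc i) B≟ true))
  ... | no none | _ = inj₂ (false , absorb-Split s λ i p → ¬-not (λ q → none (i , p , q)))
  ... | yes _ | no none = inj₂ (false , absorb-Split (swap-Split (λ i j → es _ _) s)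
                                        λ i p → ¬-not (λ q → none (i , not-≡ p , q)))
  ... | yes (u , su , eu) | yes (v , sv , ev)
    with any? (λ i → e zero (suc i) B≟ false)
  ... | no none = inj₂ (true , uniform-Split true u λ i → ¬-not (λ q → none (i , q)))
  ... | yes (y , ey) with Split.side s y in sy
  ...   | true  = map id (false ,_) (cut-or-P₄ s y sy ey v sv ev)
  ...   | false = map id (false ,_)
                    (cut-or-P₄ (swap-Split (λ i j → es _ _) s) y (cong not sy) ey u (cong not su) eu)

-- Induction on the number of vertices: a graph without induced P₄ is disconnected or has a
-- disconnected complement.
P₄-or-Split : ∀ m (e : Fin (2 + m) → Fin (2 + m) → Bool) → Symm e → InducedP₄ e ⊎ ∃ (Split e)
P₄-or-Split zero e es = inj₂ (e 0F 1F , uniform-Split e es (e 0F 1F) zero λ { zero → refl })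
P₄-or-Split (suc m) e es with P₄-or-Split m (λ i j → e (suc i) (suc j)) (λ i j → es _ _)
... | inj₁ p = inj₁ record
  { InducedP₄ p
  ; w = suc (InducedP₄.w p) ; x = suc (InducedP₄.x p)
  ; y = suc (InducedP₄.y p) ; z = suc (InducedP₄.z p) }
... | inj₂ (false , s) = extend-Split e es s
-- A join becomes a disconnection in the complement, where `extend-Split` applies; both outcomes
-- carry over back.
... | inj₂ (true , s) with extend-Split (co e) (λ i j → cong not (es i j))
                             record { Split s ; across = λ i j p q → cong not (Split.across s i j p q) }
...   | inj₁ p = inj₁ (co-P₄ es p)
...   | inj₂ (b , t) = inj₂ (not b , co-Split t)

-- Cycles, and graphs given by decidable relations.

cycle-neighbours : ∀ {n} {G : Graph n} (C : Cycle G) → let open Cycle C in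
  ∀ i → ∃₂ λ j k → j ≢ k × Adj G (f i) (f j) × Adj G (f i) (f k)
cycle-neighbours {G = G} C zero =
  1F , fromℕ _ , (λ ()) , step zero , Adj-sym G close
  where open Cycle C
cycle-neighbours {G = G} C (suc i) with view i
-- The last vertex of the cycle, whose successor is `f zero` by `close`.
... | ‵fromℕ     = inject₁ (fromℕ _) , zero , (λ ()) , Adj-sym G (step (fromℕ _)) , close
  where open Cycle C
... | ‵inject₁ j = inject₁ (inject₁ j) , suc (suc j) , ≢ss j , Adj-sym G (step (inject₁ j)) , step (suc j)
  where
  open Cycle C
  ≢ss : ∀ {m} (j : Fin m) → inject₁ (inject₁ j) ≢ suc (suc j)
  ≢ss (suc j) eq = ≢ss j (suc-injective eq)

module _ {n : ℕ} (R : Fin n → Fin n → Set) (R? : ∀ u v → Dec (R u v))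
         (R-sym : ∀ {u v} → R u v → R v u) (R-irrefl : ∀ {v} → ¬ R v v) where

  relGraph : Graph n
  relGraph = record
    { adj        = λ u v → does (R? u v)
    ; adj-sym    = λ u v → does-⇔ (mk⇔ R-sym R-sym) (R? u v) (R? v u)
    ; adj-irrefl = λ v → dec-false (R? v v) R-irrefl
    }

  relGraph⁻ : ∀ {u v} → Adj relGraph u v → R u v
  relGraph⁻ {u} {v} p with yes r ← R? u v = r

  relGraph⁺ : ∀ {u v} → R u v → Adj relGraph u v
  relGraph⁺ {u} {v} r with R? u v
  ... | yes _ = _
  ... | no ¬r = ¬r r

-- Rainbow trees grown leaf by leaf

module RainbowTrees {n k : ℕ} (G : Graph n) (c : Fin n → Fin n → Fin k)
                    (c-sym : ∀ u v → c u v ≡ c v u) where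

  coloring : EdgeColoring G k
  coloring = record { color = λ u v _ → c u v ; color-sym = λ u v _ _ → c-sym u v }

  -- Both indices are bounds: the tree may contain vertices outside `vs`, and `P` may hold of
  -- colours that do not occur. Freshness of a colour can thus be tested against `P` without
  -- inspecting the tree.
  record RainbowTree (vs : List (Fin n)) (P : Fin k → Set) : Set where
    field
      tree    : Subgraph G
      isTree  : IsTree tree
      rainbow : Rainbow coloring tree
    open Subgraph tree public
    open IsTree isTree public
    field
      spans   : All (_∈ verts) vs
      colours : ∀ {u v} → Adj edges u v → P (c u v)

  weaken : ∀ {vs ws P Q} → (∀ {v} → v ∈ₗ ws → v ∈ₗ vs) → (∀ {x} → P x → Q x) →
           RainbowTree vs P → RainbowTree ws Q
  weaken ws⊆vs P⊆Q t = record
    { tree = tree ; isTree = isTree ; rainbow = rainbow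
    ; spans = All.tabulate (All.lookup spans ∘ ws⊆vs) ; colours = P⊆Q ∘ colours }
    where open RainbowTree t

  singleton : ∀ v → RainbowTree (v ∷ []) (λ _ → ⊥)
  singleton v = record
    { tree    = record
      { verts = ⁅ v ⁆
      ; edges = record { adj = λ _ _ → false ; adj-sym = λ _ _ → refl ; adj-irrefl = λ _ → refl }
      ; edges⊆G = λ _ _ () ; endpoints = λ _ _ () }
    ; isTree  = record
      { nonempty = v , x∈⁅x⁆ v
      ; connected = λ x y x∈ y∈ →
          subst (Star _ x) (trans (x∈⁅y⁆⇒x≡y v x∈) (sym (x∈⁅y⁆⇒x≡y v y∈))) ε
      ; acyclic = λ C → Cycle.step C zero }
    ; rainbow = λ _ _ _ _ ()
    ; spans   = x∈⁅x⁆ v ∷ []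
    ; colours = λ () }

  module _ {vs P} (t : RainbowTree vs P) {u v : Fin n}
           (u∈ : u ∈ RainbowTree.verts t) (v∉ : v ∉ RainbowTree.verts t)
           (uv : Adj G u v) (fresh : ¬ P (c u v)) where

    open RainbowTree t

    private
      NewEdge : Fin n → Fin n → Set
      NewEdge x y = (x ≡ u × y ≡ v) ⊎ (x ≡ v × y ≡ u)

      Edge : Fin n → Fin n → Set
      Edge x y = Adj edges x y ⊎ NewEdge x y

      Edge? : ∀ x y → Dec (Edge x y)
      Edge? x y = Adj? edges x y ⊎-dec (((x ≟ u) ×-dec (y ≟ v)) ⊎-dec ((x ≟ v) ×-dec (y ≟ u)))

      Edge-sym : ∀ {x y} → Edge x y → Edge y x
      Edge-sym (inj₁ p)              = inj₁ (Adj-sym edges p)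
      Edge-sym (inj₂ (inj₁ (p , q))) = inj₂ (inj₂ (q , p))
      Edge-sym (inj₂ (inj₂ (p , q))) = inj₂ (inj₁ (q , p))

      Edge-irrefl : ∀ {x} → ¬ Edge x x
      Edge-irrefl (inj₁ p)                    = Adj-irrefl edges p
      Edge-irrefl (inj₂ (inj₁ (refl , refl))) = Adj-irrefl G uv
      Edge-irrefl (inj₂ (inj₂ (refl , refl))) = Adj-irrefl G uv

      edges⁺ : Graph n
      edges⁺ = relGraph Edge Edge? Edge-sym Edge-irrefl

      to : ∀ {x y} → Edge x y → Adj edges⁺ x y
      to = relGraph⁺ Edge Edge? Edge-sym Edge-irrefl

      from : ∀ {x y} → Adj edges⁺ x y → Edge x y
      from = relGraph⁻ Edge Edge? Edge-sym Edge-irrefl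

      colour-new : ∀ {x y} → NewEdge x y → c x y ≡ c u v
      colour-new (inj₁ (refl , refl)) = refl
      colour-new (inj₂ (refl , refl)) = c-sym _ _

      to-root : ∀ x → x ∈ verts ∪ ⁅ v ⁆ → Star (Adj edges⁺) x u
      to-root x x∈ with x∈p∪q⁻ verts ⁅ v ⁆ x∈
      ... | inj₁ p = Star.map (to ∘ inj₁) (connected x u p u∈)
      ... | inj₂ p = to (inj₂ (inj₂ (x∈⁅y⁆⇒x≡y v p , refl))) ◅ ε

      leaf : ∀ {x} → Edge v x → x ≡ u
      leaf (inj₁ p)                 = contradiction (proj₁ (endpoints _ _ p)) v∉
      leaf (inj₂ (inj₁ (refl , _))) = contradiction u∈ v∉
      leaf (inj₂ (inj₂ (_ , eq)))   = eq

      -- A vertex on a cycle has two distinct neighbours, so the leaf v lies on none.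
      no-cycle : Acyclic edges⁺
      no-cycle C = acyclic record
        { m = m ; f = f ; injective = injective
        ; step = λ i → old (from (step i)) ; close = old (from close) }
        where
        open Cycle C
        off : ∀ i → f i ≢ v
        off i eq with cycle-neighbours C i
        ... | j , l , j≢l , p , q =
          j≢l (injective (trans (leaf (subst (λ w → Edge w _) eq (from p)))
                           (sym (leaf (subst (λ w → Edge w _) eq (from q))))))
        old : ∀ {i j} → Edge (f i) (f j) → Adj edges (f i) (f j)
        old (inj₁ p)              = p
        old (inj₂ (inj₁ (_ , q))) = contradiction q (off _)
        old (inj₂ (inj₂ (p , _))) = contradiction p (off _)

    -- Since `v` is new it becomes a leaf, which creates no cycle. Since its colour lies outside
    -- `P`, the new edge can agree in colour only with itself.
    addLeaf : RainbowTree (v ∷ vs) (λ x → x ≡ c u v ⊎ P x)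
    addLeaf = record
      { tree    = record
        { verts = verts ∪ ⁅ v ⁆
        ; edges = edges⁺
        ; edges⊆G = λ x y p → ⊆G (from p)
        ; endpoints = λ x y p → ends (from p) }
      ; isTree  = record
        { nonempty = u , x∈p∪q⁺ (inj₁ u∈)
        ; connected = λ x y x∈ y∈ → to-root x x∈ ◅◅ Star.reverse (Adj-sym edges⁺) (to-root y y∈)
        ; acyclic = no-cycle }
      ; rainbow = λ x y x′ y′ p p′ → distinct (from p) (from p′)
      ; spans   = v∈ ∷ All.map (x∈p∪q⁺ ∘ inj₁) spans
      ; colours = λ p → [ inj₂ ∘ colours , inj₁ ∘ colour-new ]′ (from p) }
      where
      v∈ : v ∈ verts ∪ ⁅ v ⁆
      v∈ = x∈p∪q⁺ (inj₂ (x∈⁅x⁆ v))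

      ⊆G : ∀ {x y} → Edge x y → Adj G x y
      ⊆G (inj₁ p)                    = edges⊆G _ _ p
      ⊆G (inj₂ (inj₁ (refl , refl))) = uv
      ⊆G (inj₂ (inj₂ (refl , refl))) = Adj-sym G uv

      ends : ∀ {x y} → Edge x y → x ∈ verts ∪ ⁅ v ⁆ × y ∈ verts ∪ ⁅ v ⁆
      ends (inj₁ p) with endpoints _ _ p
      ... | x∈ , y∈ = x∈p∪q⁺ (inj₁ x∈) , x∈p∪q⁺ (inj₁ y∈)
      ends (inj₂ (inj₁ (refl , refl))) = x∈p∪q⁺ (inj₁ u∈) , v∈
      ends (inj₂ (inj₂ (refl , refl))) = v∈ , x∈p∪q⁺ (inj₁ u∈)

      distinct : ∀ {x y x′ y′} → Edge x y → Edge x′ y′ → c x y ≡ c x′ y′ →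
                 (x ≡ x′ × y ≡ y′) ⊎ (x ≡ y′ × y ≡ x′)
      distinct (inj₁ p) (inj₁ q) eq = rainbow _ _ _ _ p q eq
      distinct (inj₁ p) (inj₂ q) eq =
        contradiction (subst P (trans eq (colour-new q)) (colours p)) fresh
      distinct (inj₂ p) (inj₁ q) eq =
        contradiction (subst P (trans (sym eq) (colour-new p)) (colours q)) fresh
      distinct (inj₂ (inj₁ (p , q))) (inj₂ (inj₁ (p′ , q′))) _ = inj₁ (trans p (sym p′) , trans q (sym q′))
      distinct (inj₂ (inj₁ (p , q))) (inj₂ (inj₂ (p′ , q′))) _ = inj₂ (trans p (sym q′) , trans q (sym p′))
      distinct (inj₂ (inj₂ (p , q))) (inj₂ (inj₁ (p′ , q′))) _ = inj₂ (trans p (sym q′) , trans q (sym p′))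
      distinct (inj₂ (inj₂ (p , q))) (inj₂ (inj₂ (p′ , q′))) _ = inj₁ (trans p (sym p′) , trans q (sym q′))

  -- If `v` already lies in the tree, the tree stays as it is and the colour is merely recorded as
  -- possibly used. Callers therefore never have to show that a vertex is new.
  grow : ∀ {vs P} → RainbowTree vs P → ∀ {u v x} → u ∈ₗ vs → Adj G u v → c u v ≡ x → ¬ P x →
         RainbowTree (v ∷ vs) (λ y → y ≡ x ⊎ P y)
  grow t {u} {v} u∈ uv refl fresh with v ∈? RainbowTree.verts t
  ... | no v∉  = addLeaf t (All.lookup (RainbowTree.spans t) u∈) v∉ uv fresh
  ... | yes v∈ = record
    { tree = tree ; isTree = isTree ; rainbow = rainbow ; spans = v∈ ∷ spans ; colours = inj₂ ∘ colours }
    where open RainbowTree t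

-- Three-element sets and the size of their trees.

elements : ∀ {n m} (S : Subset n) → ∣ S ∣ ≡ m →
  ∃ λ (f : Fin m → Fin n) → Injective _≡_ _≡_ f × (∀ i → f i ∈ S) × (∀ {v} → v ∈ S → ∃ λ i → v ≡ f i)
elements Vec.[] refl = (λ ()) , (λ { {()} }) , (λ ()) , λ ()
elements (outside Vec.∷ S) eq with elements S eq
... | f , inj , f∈ , cover =
  suc ∘ f , inj ∘ suc-injective , Vec.there ∘ f∈ ,
  λ { (Vec.there v∈) → case cover v∈ of λ { (i , refl) → i , refl } }
elements (inside Vec.∷ S) refl with elements S refl
... | f , inj , f∈ , cover = g , g-inj _ _ , g∈ , g-cover
  where
  g : Fin (suc ∣ S ∣) → Fin _
  g zero    = zero
  g (suc i) = suc (f i)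
  g-inj : ∀ i j → g i ≡ g j → i ≡ j
  g-inj zero zero _ = refl
  g-inj (suc i) (suc j) eq = cong suc (inj (suc-injective eq))
  g∈ : ∀ i → g i ∈ inside Vec.∷ S
  g∈ zero = Vec.here
  g∈ (suc i) = Vec.there (f∈ i)
  g-cover : ∀ {v} → v ∈ inside Vec.∷ S → ∃ λ i → v ≡ g i
  g-cover Vec.here = zero , refl
  g-cover (Vec.there v∈) = case cover v∈ of λ { (i , refl) → suc i , refl }

edge-of : ∀ {n} (G : Graph n) {u v} → Adj G u v →
          ∃ λ e → e ∈ₗ edgeList G × (u ≡ proj₁ e ⊎ u ≡ proj₂ e)
edge-of G {u} {v} p with <-cmp u v
... | tri< u<v _ _ = (u , v) , ∈-filter⁺ _ (∈-cartesianProduct⁺ (∈-allFin u) (∈-allFin v)) (u<v , p) , inj₁ refl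
... | tri≈ _ refl _ = ⊥-elim (Adj-irrefl G p)
... | tri> _ _ v<u = (v , u) , ∈-filter⁺ _ (∈-cartesianProduct⁺ (∈-allFin v) (∈-allFin u)) (v<u , Adj-sym G p) , inj₂ refl

short⇒unique : ∀ {A : Set} {x y : A} {xs} → length xs < 2 → x ∈ₗ xs → y ∈ₗ xs → x ≡ y
short⇒unique _ (here refl) (here refl) = refl
short⇒unique (s≤s (s≤s ())) (here _) (there (here _))
short⇒unique (s≤s (s≤s ())) (here _) (there (there _))
short⇒unique (s≤s (s≤s ())) (there (here _)) _
short⇒unique (s≤s (s≤s ())) (there (there _)) _

-- Each of the three vertices is joined to another one inside the tree, so it is an end of some
-- edge. A single edge has only two ends.
STree-size : ∀ {n} {G : Graph n} {S : Subset n} (H : Subgraph G) →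
             ∣ S ∣ ≡ 3 → IsSTree S H → 2 ≤ numEdges (Subgraph.edges H)
STree-size {S = S} H ∣S∣ (isTree , S⊆) with elements S ∣S∣
... | f , inj , f∈ , _ = ℕₚ.≮⇒≥ impossible
  where
  open Subgraph H
  open IsTree isTree
  edge-at : ∀ i j → i ≢ j → ∃ λ e → e ∈ₗ edgeList edges × (f i ≡ proj₁ e ⊎ f i ≡ proj₂ e)
  edge-at i j i≢j with f i | inj {i} {j} | connected (f i) (f j) (S⊆ (f∈ i)) (S⊆ (f∈ j))
  ... | _ | i≡j | ε     = contradiction (i≡j refl) i≢j
  ... | _ | _   | p ◅ _ = edge-of edges p
  impossible : ¬ numEdges edges < 2
  impossible short with edge-at 0F 1F (λ ()) | edge-at 1F 0F (λ ()) | edge-at 2F 0F (λ ())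
  -- All three edges coincide, so two of the three vertices are the same end of it.
  ... | e , e∈ , p | e′ , e′∈ , q | e″ , e″∈ , s
    with refl ← short⇒unique short e∈ e′∈ | refl ← short⇒unique short e∈ e″∈ with p | q | s
  ... | inj₁ a | inj₁ b | _      = contradiction (inj {0F} {1F} (trans a (sym b))) λ ()
  ... | inj₂ a | inj₂ b | _      = contradiction (inj {0F} {1F} (trans a (sym b))) λ ()
  ... | inj₁ a | inj₂ b | inj₁ d = contradiction (inj {0F} {2F} (trans a (sym d))) λ ()
  ... | inj₁ a | inj₂ b | inj₂ d = contradiction (inj {1F} {2F} (trans b (sym d))) λ ()
  ... | inj₂ a | inj₁ b | inj₁ d = contradiction (inj {1F} {2F} (trans b (sym d))) λ ()
  ... | inj₂ a | inj₁ b | inj₂ d = contradiction (inj {0F} {2F} (trans a (sym d))) λ ()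

-- Three vertices outside the core leave it by legs with three different
-- colours, which a rainbow tree on the three ends in the core leaves unused.
module Legs {n k : ℕ} (G : Graph n) (c : Fin n → Fin n → Fin k) (c-sym : ∀ u v → c u v ≡ c v u)
  (Core : Fin n → Set) (Core? : ∀ v → Dec (Core v)) (CoreColour : Fin k → Set)
  (core-tree : ∀ {x y z} → Core x → Core y → Core z →
               RainbowTrees.RainbowTree G c c-sym (x ∷ y ∷ z ∷ []) CoreColour)
  (legColour : Fin n → Fin 3 → Fin k)
  (leg : ∀ v → ¬ Core v → ∀ ℓ → ∃ λ d → Core d × Adj G d v × c d v ≡ legColour v ℓ)
  (leg∉core : ∀ v ℓ → ¬ CoreColour (legColour v ℓ))
  (leg-distinct : ∀ {u v} → ¬ Core u → ¬ Core v → u ≢ v →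
                  ∀ {ℓ ℓ′} → ℓ ≢ ℓ′ → legColour u ℓ ≢ legColour v ℓ′)
  where

  open RainbowTrees G c c-sym

  private
    -- Treats all members of the set alike: a core vertex is its own base, any other vertex hangs on
    -- its base by leg `ℓ`.
    record Anchor (v : Fin n) (ℓ : Fin 3) : Set where
      field
        base   : Fin n
        core   : Core base
        attach : v ≡ base ⊎ (¬ Core v × Adj G base v × c base v ≡ legColour v ℓ)

    anchor : ∀ v ℓ → Anchor v ℓ
    anchor v ℓ with Core? v
    ... | yes p = record { base = v ; core = p ; attach = inj₁ refl }
    ... | no ¬p with leg v ¬p ℓ
    ...   | d , d∈ , dv , eq = record { base = d ; core = d∈ ; attach = inj₂ (¬p , dv , eq) }

    -- A core vertex uses no leg, so it blocks no colour; `leg-distinct` compares only vertices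
    -- outside the core.
    LegUsed : Fin n → Fin 3 → Fin k → Set
    LegUsed v ℓ x = ¬ Core v × x ≡ legColour v ℓ

    add : ∀ {vs P v ℓ} (A : Anchor v ℓ) → Anchor.base A ∈ₗ vs → (¬ Core v → ¬ P (legColour v ℓ)) →
          RainbowTree vs P → RainbowTree (v ∷ vs) (λ x → LegUsed v ℓ x ⊎ P x)
    add A d∈ fresh t with Anchor.attach A
    ... | inj₁ refl = weaken (λ { (here refl) → d∈ ; (there p) → p }) inj₂ t
    ... | inj₂ (¬v , dv , eq) = weaken id (map (¬v ,_) id) (grow t d∈ dv eq (fresh ¬v))

  -- Member number `i` of the set takes its leg number `i`, so the legs in use have pairwise
  -- different numbers and hence different colours.
  rainbow-coloring : Is3RainbowColoring G coloring
  rainbow-coloring S ∣S∣ with elements S ∣S∣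
  ... | f , inj , _ , cover = tree , (isTree , λ v∈ → S⊆ (cover v∈)) , rainbow
    where
    A : ∀ i → Anchor (f i) i
    A i = anchor (f i) i

    differ : ∀ i j → i ≢ j → ¬ Core (f j) → ¬ LegUsed (f i) i (legColour (f j) j)
    differ i j i≢j ¬j (¬i , eq) = leg-distinct ¬j ¬i (i≢j ∘ sym ∘ inj) (i≢j ∘ sym) eq

    t : RainbowTree (f 2F ∷ f 1F ∷ f 0F ∷ _) _
    -- The members added before precede the three bases in the list, so the base of `A 2F` is found
    -- at position 4.
    t = add (A 2F) (there (there (there (there (here refl)))))
          (λ ¬v → [ differ 1F 2F (λ ()) ¬v , [ differ 0F 2F (λ ()) ¬v , leg∉core _ _ ]′ ]′)
       (add (A 1F) (there (there (here refl)))
          (λ ¬v → [ differ 0F 1F (λ ()) ¬v , leg∉core _ _ ]′)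
       (add (A 0F) (here refl) (λ _ → leg∉core _ _)
       (core-tree (Anchor.core (A 0F)) (Anchor.core (A 1F)) (Anchor.core (A 2F)))))

    open RainbowTree t

    S⊆ : ∀ {v} → ∃ (λ i → v ≡ f i) → v ∈ verts
    S⊆ (0F , refl) = All.lookup spans (there (there (here refl)))
    S⊆ (1F , refl) = All.lookup spans (there (here refl))
    S⊆ (2F , refl) = All.lookup spans (here refl)

-- The two colourings of a join.

true≢false : ∀ {b : Bool} → b ≡ true → b ≢ false
true≢false refl ()

-- Both sides of the join have three vertices h s 0, h s 1, h s 2. Index 0, 1, 2
-- of the core end is the colour of a leg; the colours 3, …, 7 are those of the
-- spanning tree of the core with edges from h true 0 to h false j and from
-- h true 1, h true 2 to h false 0.
module Wide {n : ℕ} (G : Graph n) (side : Fin n → Bool)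
  (join : ∀ {u v} → side u ≡ true → side v ≡ false → Adj G u v)
  (h : Bool → Fin 3 → Fin n) (h-side : ∀ s i → side (h s i) ≡ s)
  (h-inj : ∀ s {i j} → h s i ≡ h s j → i ≡ j) where

  private
    Core : Fin n → Set
    Core v = ∃ λ i → v ≡ h (side v) i

    Core? : ∀ v → Dec (Core v)
    Core? v = any? λ i → v ≟ h (side v) i

    h-core : ∀ s i → Core (h s i)
    h-core s i = i , cong (λ b → h b i) (sym (h-side s i))

    -- The colour of an edge depends on the sides and indices of its ends alone; `nothing` marks a
    -- vertex outside the core.
    index : Fin n → Maybe (Fin 3)
    index v with Core? v
    ... | yes (i , _) = just i
    ... | no  _       = nothing

    index-h : ∀ s i → index (h s i) ≡ just i
    index-h s i with Core? (h s i)
    ... | yes (j , eq) = cong just (h-inj s (sym (trans eq (cong (λ b → h b j) (h-side s i)))))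
    ... | no ¬core     = contradiction (h-core s i) ¬core

    index-out : ∀ v → ¬ Core v → index v ≡ nothing
    index-out v ¬core with Core? v
    ... | yes core = contradiction core ¬core
    ... | no _     = refl

    coreColour : Fin 3 → Fin 3 → Fin 5
    coreColour 0F j  = j ↑ˡ 2
    -- The rows of 1 and 2 may be constant, as each contributes just its edge to `h false 0` to the
    -- spanning tree.
    coreColour 1F _  = 3F
    coreColour 2F _  = 4F

    col : Maybe (Fin 3) → Maybe (Fin 3) → Fin 8
    col (just i) (just j) = 3 ↑ʳ coreColour i j
    col (just i) nothing  = i ↑ˡ 5
    col nothing  (just j) = j ↑ˡ 5
    col nothing  nothing  = 0F

    crossColour : Bool → Maybe (Fin 3) → Bool → Maybe (Fin 3) → Fin 8
    crossColour true  i false j = col i j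
    crossColour false i true  j = col j i
    -- A default for edges inside a side; the trees run across the join.
    crossColour _     _ _     _ = 0F

    crossColour-sym : ∀ s i t j → crossColour s i t j ≡ crossColour t j s i
    crossColour-sym true  _ true  _ = refl
    crossColour-sym true  _ false _ = refl
    crossColour-sym false _ true  _ = refl
    crossColour-sym false _ false _ = refl

    c : Fin n → Fin n → Fin 8
    c u v = crossColour (side u) (index u) (side v) (index v)

    c-sym : ∀ u v → c u v ≡ c v u
    c-sym u v = crossColour-sym (side u) (index u) (side v) (index v)

    open RainbowTrees G c c-sym

    c-at : ∀ {u v s i t j} → side u ≡ s → index u ≡ i → side v ≡ t → index v ≡ j →
           c u v ≡ crossColour s i t j
    c-at refl refl refl refl = refl

    c-core : ∀ i j → c (h true i) (h false j) ≡ 3 ↑ʳ coreColour i j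
    c-core i j = c-at (h-side true i) (index-h true i) (h-side false j) (index-h false j)

    c-core′ : ∀ i j → c (h false j) (h true i) ≡ 3 ↑ʳ coreColour i j
    c-core′ i j = trans (c-sym (h false j) (h true i)) (c-core i j)

    CoreColour : Fin 8 → Set
    CoreColour x = ∃ λ y → x ≡ 3 ↑ʳ y

    adj-core : ∀ i j → Adj G (h true i) (h false j)
    adj-core i j = join (h-side true i) (h-side false j)

    coreList : List (Fin n)
    coreList = h true 2F ∷ h true 1F ∷ h false 2F ∷ h false 1F ∷ h false 0F ∷ h true 0F ∷ []

    -- One tree with five edges of five colours spans all six core vertices and so serves every
    -- triple of bases.
    core : RainbowTree coreList CoreColour
    core =
      weaken id (λ { (inj₁ p) → _ , p ; (inj₂ (inj₁ p)) → _ , p ; (inj₂ (inj₂ (inj₁ p))) → _ , p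
                   ; (inj₂ (inj₂ (inj₂ (inj₁ p)))) → _ , p ; (inj₂ (inj₂ (inj₂ (inj₂ (inj₁ p))))) → _ , p })
      (grow (grow (grow (grow (grow (singleton (h true 0F))
        (here refl) (adj-core 0F 0F) (c-core 0F 0F) λ ())
        (there (here refl)) (adj-core 0F 1F) (c-core 0F 1F) λ { (inj₁ ()) ; (inj₂ ()) })
        (there (there (here refl))) (adj-core 0F 2F) (c-core 0F 2F) λ { (inj₁ ()) ; (inj₂ (inj₁ ())) ; (inj₂ (inj₂ ())) })
        (there (there (here refl))) (Adj-sym G (adj-core 1F 0F)) (c-core′ 1F 0F)
          λ { (inj₁ ()) ; (inj₂ (inj₁ ())) ; (inj₂ (inj₂ (inj₁ ()))) ; (inj₂ (inj₂ (inj₂ ()))) })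
        (there (there (there (here refl)))) (Adj-sym G (adj-core 2F 0F)) (c-core′ 2F 0F)
          λ { (inj₁ ()) ; (inj₂ (inj₁ ())) ; (inj₂ (inj₂ (inj₁ ()))) ; (inj₂ (inj₂ (inj₂ (inj₁ ())))) ; (inj₂ (inj₂ (inj₂ (inj₂ ())))) })

    core∈ : ∀ {v} → Core v → v ∈ₗ coreList
    core∈ {v} (i , eq) = subst (_∈ₗ coreList) (sym eq) (listed (side v) i)
      where
      listed : ∀ s i → h s i ∈ₗ coreList
      listed true  0F = there (there (there (there (there (here refl)))))
      listed true  1F = there (here refl)
      listed true  2F = here refl
      listed false 0F = there (there (there (there (here refl))))
      listed false 1F = there (there (there (here refl)))
      listed false 2F = there (there (here refl))

    c-leg : ∀ s v → side v ≡ s → ¬ Core v → ∀ ℓ → c (h (not s) ℓ) v ≡ ℓ ↑ˡ 5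
    c-leg true  v sv ¬core ℓ = c-at (h-side false ℓ) (index-h false ℓ) sv (index-out v ¬core)
    c-leg false v sv ¬core ℓ = c-at (h-side true ℓ) (index-h true ℓ) sv (index-out v ¬core)

    adj-leg : ∀ s v → side v ≡ s → ∀ ℓ → Adj G (h (not s) ℓ) v
    adj-leg true  v sv ℓ = Adj-sym G (join sv (h-side false ℓ))
    adj-leg false v sv ℓ = join (h-side true ℓ) sv

    -- A vertex is adjacent to the whole opposite side; leg `ℓ` leads to core vertex `ℓ` there.
    leg : ∀ v → ¬ Core v → ∀ ℓ → ∃ λ d → Core d × Adj G d v × c d v ≡ ℓ ↑ˡ 5
    leg v ¬core ℓ = h (not (side v)) ℓ , h-core _ ℓ , adj-leg _ v refl ℓ , c-leg _ v refl ¬core ℓ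

    leg∉core : ∀ (ℓ : Fin 3) → ¬ CoreColour (ℓ ↑ˡ 5)
    leg∉core 0F (_ , ())
    leg∉core 1F (_ , ())
    leg∉core 2F (_ , ())

  wide-coloring : Σ (EdgeColoring G 8) (Is3RainbowColoring G)
  wide-coloring = coloring , Legs.rainbow-coloring G c c-sym Core Core? CoreColour
    (λ x y z → weaken (λ { (here refl) → core∈ x ; (there (here refl)) → core∈ y ; (there (there (here refl))) → core∈ z }) id core)
    (λ _ ℓ → ℓ ↑ˡ 5) leg (λ _ → leg∉core) λ _ _ _ {ℓ} {ℓ′} ℓ≢ eq → ℓ≢ (↑ˡ-injective 5 ℓ ℓ′ eq)

-- Stands before `Narrow` because the parameters of that module speak of hubs.
IsHub : ∀ {n m} → (Fin n → Bool) → (Fin n → Maybe (Fin m)) → Fin m → Fin n → Set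
IsHub side class j v = side v ≡ false × class v ≡ just j

-- The side of a has at most one further vertex (the spare one). The core is a
-- together with the hubs; the hubs fall into classes, which are cliques of at
-- most two vertices. Colour 5 + j joins a to the hubs of class j, colour 3 joins
-- hubs of the same class, 4 is used at the spare vertex only, and 0, 1, 2 are the
-- legs to a, target and target′. Three hubs require colour 3 for at most one class.
module Narrow {n m : ℕ} (G : Graph n) (side : Fin n → Bool)
  (join : ∀ {u v} → side u ≡ true → side v ≡ false → Adj G u v)
  (a : Fin n) (a-side : side a ≡ true)
  (spare-unique : ∀ {u v} → side u ≡ true → side v ≡ true → u ≢ a → v ≢ a → u ≡ v)
  (class : Fin n → Maybe (Fin m))
  (class-adj : ∀ {j u v} → class u ≡ just j → class v ≡ just j → u ≢ v → Adj G u v)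
  (class-size : ∀ {j u v w} → class u ≡ just j → class v ≡ just j → class w ≡ just j →
                u ≡ v ⊎ u ≡ w ⊎ v ≡ w)
  (target target′ : Fin n → Fin n)
  (target-ok : ∀ v → side v ≡ false → class v ≡ nothing →
    (∃ λ j → IsHub side class j (target v)) × (∃ λ j → IsHub side class j (target′ v)) ×
    Adj G (target v) v × Adj G (target′ v) v × target′ v ≢ target v)
  (hub₀ : ∃₂ (IsHub side class)) where

  private
    Hub : Fin m → Fin n → Set
    Hub = IsHub side class

    data Role : Set where
      root spare out : Role
      hub : Fin m → Role

    data HasRole (v : Fin n) : Role → Set where
      root  : v ≡ a → HasRole v root
      spare : side v ≡ true → v ≢ a → HasRole v spare
      out   : side v ≡ false → class v ≡ nothing → HasRole v out
      hub   : ∀ {j} → Hub j v → HasRole v (hub j)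

    classify : ∀ v → ∃ (HasRole v)
    classify v with v ≟ a | side v in s | class v in cl
    ... | yes p | _     | _       = _ , root p
    ... | no ¬p | true  | _       = _ , spare s ¬p
    ... | no ¬p | false | nothing = _ , out s cl
    ... | no ¬p | false | just j  = _ , hub (s , cl)

    role : Fin n → Role
    role = proj₁ ∘ classify

    -- Lets the computed `role v` be read off from any evidence, without unfolding `classify`.
    role-unique : ∀ {v r r′} → HasRole v r → HasRole v r′ → r ≡ r′
    role-unique (root _) (root _) = refl
    role-unique (root p) (spare _ ¬p) = contradiction p ¬p
    role-unique (root refl) (out s _) = contradiction s (true≢false a-side)
    role-unique (root refl) (hub (s , _)) = contradiction s (true≢false a-side)
    role-unique (spare _ ¬p) (root p) = contradiction p ¬p
    role-unique (spare _ _) (spare _ _) = refl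
    role-unique (spare t _) (out s _) = contradiction s (true≢false t)
    role-unique (spare t _) (hub (s , _)) = contradiction s (true≢false t)
    role-unique (out s _) (root refl) = contradiction s (true≢false a-side)
    role-unique (out s _) (spare t _) = contradiction s (true≢false t)
    role-unique (out _ _) (out _ _) = refl
    role-unique (out _ p) (hub (_ , q)) = case trans (sym p) q of λ ()
    role-unique (hub (s , _)) (root refl) = contradiction s (true≢false a-side)
    role-unique (hub (s , _)) (spare t _) = contradiction s (true≢false t)
    role-unique (hub (_ , q)) (out _ p) = case trans (sym p) q of λ ()
    role-unique (hub (_ , p)) (hub (_ , q)) with refl ← trans (sym p) q = refl

    has⇒role : ∀ {v r} → HasRole v r → role v ≡ r
    has⇒role {v} = role-unique (proj₂ (classify v))

    Colour : Set
    Colour = Fin (5 + m)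

    -- Every hub other than the first target gets colour 2; this includes the second target, as the
    -- two differ.
    toTarget : Fin n → Fin n → Colour
    toTarget v t with t ≟ target v
    ... | yes _ = 1F
    ... | no _  = 2F

    col : Fin n → Fin n → Role → Role → Colour
    col u v root    (hub j) = 5 ↑ʳ j
    col u v (hub j) root    = 5 ↑ʳ j
    col u v root    out     = 0F
    col u v out     root    = 0F
    col u v (hub _) out     = toTarget v u
    col u v out     (hub _) = toTarget u v
    col u v spare   _       = 4F
    col u v _       spare   = 4F
    -- Two hubs fall under this clause whatever their classes; trees use such an edge only inside a
    -- class.
    col u v _       _       = 3F

    col-sym : ∀ u v r s → col u v r s ≡ col v u s r
    col-sym u v root root = refl
    col-sym u v root spare = refl
    col-sym u v root out = refl
    col-sym u v root (hub _) = refl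
    col-sym u v spare root = refl
    col-sym u v spare spare = refl
    col-sym u v spare out = refl
    col-sym u v spare (hub _) = refl
    col-sym u v out root = refl
    col-sym u v out spare = refl
    col-sym u v out out = refl
    col-sym u v out (hub _) = refl
    col-sym u v (hub _) root = refl
    col-sym u v (hub _) spare = refl
    col-sym u v (hub _) out = refl
    col-sym u v (hub _) (hub _) = refl

    c : Fin n → Fin n → Colour
    c u v = col u v (role u) (role v)

    c-sym : ∀ u v → c u v ≡ c v u
    c-sym u v = col-sym u v (role u) (role v)

    c-roles : ∀ {u v r s} → HasRole u r → HasRole v s → c u v ≡ col u v r s
    c-roles p q = cong₂ (col _ _) (has⇒role p) (has⇒role q)

    open RainbowTrees G c c-sym

    data CoreRole : Role → Set where
      root : CoreRole root
      hub  : ∀ {j} → CoreRole (hub j)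

    CoreRole? : ∀ r → Dec (CoreRole r)
    CoreRole? root    = yes root
    CoreRole? spare   = no λ ()
    CoreRole? out     = no λ ()
    CoreRole? (hub _) = yes hub

    Core : Fin n → Set
    Core v = CoreRole (role v)

    has⇒core : ∀ {v r} → HasRole v r → CoreRole r → Core v
    has⇒core p = subst CoreRole (sym (has⇒role p))

    CoreColour : Colour → Set
    CoreColour x = x ≡ 3F ⊎ ∃ λ j → x ≡ 5 ↑ʳ j

    a-hub : ∀ {j v} → Hub j v → Adj G a v
    a-hub (s , _) = join a-side s

    c-a-hub : ∀ {j v} → Hub j v → c a v ≡ 5 ↑ʳ j
    c-a-hub p = c-roles (root refl) (hub p)

    c-hub-hub : ∀ {j l u v} → Hub j u → Hub l v → c u v ≡ 3F
    c-hub-hub p q = c-roles (hub p) (hub q)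

    5↑ʳ≢ : ∀ {i j : Fin m} → i ≢ j → _≢_ {A = Colour} (5 ↑ʳ i) (5 ↑ʳ j)
    5↑ʳ≢ i≢j = i≢j ∘ ↑ʳ-injective 5 _ _

    one : ∀ {j u} → Hub j u → RainbowTree (u ∷ a ∷ []) (λ x → x ≡ 5 ↑ʳ j ⊎ ⊥)
    one p = grow (singleton a) (here refl) (a-hub p) (c-a-hub p) λ ()

    two : ∀ {j l u v} → Hub j u → Hub l v → j ≢ l →
          RainbowTree (v ∷ u ∷ a ∷ []) (λ x → x ≡ 5 ↑ʳ l ⊎ x ≡ 5 ↑ʳ j ⊎ ⊥)
    two p q j≢l = grow (one p) (there (here refl)) (a-hub q) (c-a-hub q)
                    λ { (inj₁ eq) → 5↑ʳ≢ j≢l (sym eq) }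

    -- All hubs of a class have the same colour towards `a`, so a second one cannot hang on `a` as
    -- well. It hangs on the first one by colour 3.
    link : ∀ {vs P j u v} → Hub j u → Hub j v → u ∈ₗ vs → ¬ P 3F → RainbowTree vs P →
           RainbowTree (v ∷ vs) (λ x → x ≡ 3F ⊎ P x)
    link {u = u} {v} p q u∈ fresh t with u ≟ v
    ... | yes refl = weaken (λ { (here refl) → u∈ ; (there w∈) → w∈ }) inj₂ t
    ... | no u≢v   = grow t u∈ (class-adj (proj₂ p) (proj₂ q) u≢v) (c-hub-hub p q) fresh

    HubTree : Fin n → Fin n → Fin n → Set
    HubTree u v w = RainbowTree (a ∷ u ∷ v ∷ w ∷ []) CoreColour

    all-distinct : ∀ {i j l u v w} → Hub i u → Hub j v → Hub l w → i ≢ j → i ≢ l → j ≢ l → HubTree u v w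
    all-distinct p q s i≢j i≢l j≢l = weaken
      (λ { (here refl) → there (there (there (here refl)))
         ; (there (here refl)) → there (there (here refl))
         ; (there (there (here refl))) → there (here refl)
         ; (there (there (there (here refl)))) → here refl })
      (λ { (inj₁ x) → inj₂ (_ , x) ; (inj₂ (inj₁ x)) → inj₂ (_ , x) ; (inj₂ (inj₂ (inj₁ x))) → inj₂ (_ , x) })
      (grow (two p q i≢j) (there (there (here refl))) (a-hub s) (c-a-hub s)
        λ { (inj₁ eq) → 5↑ʳ≢ j≢l (sym eq) ; (inj₂ (inj₁ eq)) → 5↑ʳ≢ i≢l (sym eq) })

    pair-and-one : ∀ {j l u v w} → Hub j u → Hub j v → Hub l w → j ≢ l → HubTree u v w
    pair-and-one p q s j≢l = weaken
      (λ { (here refl) → there (there (there (here refl)))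
         ; (there (here refl)) → there (there (here refl))
         ; (there (there (here refl))) → here refl
         ; (there (there (there (here refl)))) → there (here refl) })
      (λ { (inj₁ x) → inj₁ x ; (inj₂ (inj₁ x)) → inj₂ (_ , x) ; (inj₂ (inj₂ (inj₁ x))) → inj₂ (_ , x) })
      (link p q (there (here refl)) (λ { (inj₁ ()) ; (inj₂ (inj₁ ())) ; (inj₂ (inj₂ ())) }) (two p s j≢l))

    pair : ∀ {j u v} → Hub j u → Hub j v → RainbowTree (v ∷ u ∷ a ∷ []) CoreColour
    pair p q = weaken id (λ { (inj₁ x) → inj₁ x ; (inj₂ (inj₁ x)) → inj₂ (_ , x) })
      (link p q (here refl) (λ { (inj₁ ()) ; (inj₂ ()) }) (one p))

    -- Two of the three hubs coincide, so one edge of colour 3 is enough.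
    all-same : ∀ {j u v w} → Hub j u → Hub j v → Hub j w → HubTree u v w
    all-same p q s with class-size (proj₂ p) (proj₂ q) (proj₂ s)
    ... | inj₁ refl = weaken
      (λ { (here refl) → there (there (here refl))
         ; (there (here refl)) → there (here refl)
         ; (there (there (here refl))) → there (here refl)
         ; (there (there (there (here refl)))) → here refl }) id (pair p s)
    ... | inj₂ (inj₁ refl) = weaken
      (λ { (here refl) → there (there (here refl))
         ; (there (here refl)) → there (here refl)
         ; (there (there (here refl))) → here refl
         ; (there (there (there (here refl)))) → there (here refl) }) id (pair p q)
    ... | inj₂ (inj₂ refl) = weaken
      (λ { (here refl) → there (there (here refl))
         ; (there (here refl)) → there (here refl)
         ; (there (there (here refl))) → here refl
         ; (there (there (there (here refl)))) → here refl }) id (pair p q)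

    hub-tree : ∀ {i j l u v w} → Hub i u → Hub j v → Hub l w → HubTree u v w
    hub-tree {i} {j} {l} p q s with i ≟ j | i ≟ l | j ≟ l
    ... | yes refl | yes refl | _        = all-same p q s
    ... | yes refl | no i≢l   | _        = pair-and-one p q s i≢l
    ... | no i≢j   | yes refl | _        = weaken
      (λ { (here refl) → here refl
         ; (there (here refl)) → there (here refl)
         ; (there (there (here refl))) → there (there (there (here refl)))
         ; (there (there (there (here refl)))) → there (there (here refl)) }) id (pair-and-one p s q i≢j)
    ... | no i≢j   | no _     | yes refl = weaken
      (λ { (here refl) → here refl
         ; (there (here refl)) → there (there (there (here refl)))
         ; (there (there (here refl))) → there (here refl)
         ; (there (there (there (here refl)))) → there (there (here refl)) }) id (pair-and-one q s p (i≢j ∘ sym))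
    ... | no i≢j   | no i≢l   | no j≢l   = all-distinct p q s i≢j i≢l j≢l

    -- Every core vertex is assigned a hub, `a` receiving an arbitrary one. Since `HubTree` contains
    -- `a` too, `hub-tree` then covers all triples of core vertices.
    root-or-hub : ∀ {v} → Core v → ∃₂ λ j h → Hub j h × (v ≡ a ⊎ v ≡ h)
    root-or-hub {v} p with classify v | p
    ... | _ , root eq | _ = proj₁ hub₀ , proj₁ (proj₂ hub₀) , proj₂ (proj₂ hub₀) , inj₁ eq
    ... | _ , hub h   | _ = _ , _ , h , inj₂ refl

    core-tree : ∀ {x y z} → Core x → Core y → Core z → RainbowTree (x ∷ y ∷ z ∷ []) CoreColour
    core-tree x y z with root-or-hub x | root-or-hub y | root-or-hub z
    ... | _ , _ , p , x≡ | _ , _ , q , y≡ | _ , _ , s , z≡ = weaken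
      (λ { (here refl) → [ (λ { refl → here refl }) , (λ { refl → there (here refl) }) ]′ x≡
         ; (there (here refl)) → [ (λ { refl → here refl }) , (λ { refl → there (there (here refl)) }) ]′ y≡
         ; (there (there (here refl))) → [ (λ { refl → here refl }) , (λ { refl → there (there (there (here refl))) }) ]′ z≡ })
      id (hub-tree p q s)

    -- The three legs of the spare vertex may share colour 4: a set contains it at most once, so at
    -- most one of them is taken.
    legColourOf : Role → Fin 3 → Colour
    legColourOf spare _ = 4F
    legColourOf _     ℓ = ℓ ↑ˡ (2 + m)

    leg : ∀ v → ¬ Core v → ∀ ℓ → ∃ λ d → Core d × Adj G d v × c d v ≡ legColourOf (role v) ℓ
    leg v ¬core ℓ = from-role (proj₂ (classify v)) ¬core ℓ
      where
      from-role : ∀ {r} → HasRole v r → ¬ CoreRole r → ∀ ℓ →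
                  ∃ λ d → Core d × Adj G d v × c d v ≡ legColourOf r ℓ
      from-role (root _) ¬core = contradiction root ¬core
      from-role (hub _) ¬core = contradiction hub ¬core
      from-role v-role@(spare s _) _ ℓ =
        let _ , h , p = hub₀ in
        h , has⇒core (hub p) hub , Adj-sym G (join s (proj₁ p)) , c-roles (hub p) v-role
      from-role v-role@(out s _) _ 0F =
        a , has⇒core (root refl) root , join a-side s , c-roles (root refl) v-role
      from-role v-role@(out s cl) _ 1F =
        let (_ , p) , _ , tv , _ = target-ok v s cl in
        target v , has⇒core (hub p) hub , tv , trans (c-roles (hub p) v-role) first
        where
        first : toTarget v (target v) ≡ 1F
        first with target v ≟ target v
        ... | yes _ = refl
        ... | no ¬p = contradiction refl ¬p
      from-role v-role@(out s cl) _ 2F =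
        let _ , (_ , p) , _ , tv , ≢ = target-ok v s cl in
        target′ v , has⇒core (hub p) hub , tv , trans (c-roles (hub p) v-role) (second ≢)
        where
        second : target′ v ≢ target v → toTarget v (target′ v) ≡ 2F
        second t≢ with target′ v ≟ target v
        ... | yes p = contradiction p t≢
        ... | no _  = refl

    ↑ˡ∉core : ∀ (ℓ : Fin 3) → ¬ CoreColour (ℓ ↑ˡ (2 + m))
    ↑ˡ∉core 0F = λ { (inj₁ ()) ; (inj₂ (_ , ())) }
    ↑ˡ∉core 1F = λ { (inj₁ ()) ; (inj₂ (_ , ())) }
    ↑ˡ∉core 2F = λ { (inj₁ ()) ; (inj₂ (_ , ())) }

    leg∉core : ∀ r ℓ → ¬ CoreColour (legColourOf r ℓ)
    leg∉core spare _ (inj₁ ())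
    leg∉core spare _ (inj₂ (_ , ()))
    leg∉core root    ℓ = ↑ˡ∉core ℓ
    leg∉core out     ℓ = ↑ˡ∉core ℓ
    leg∉core (hub _) ℓ = ↑ˡ∉core ℓ

    4≢↑ˡ : ∀ (ℓ : Fin 3) → _≢_ {A = Colour} 4F (ℓ ↑ˡ (2 + m))
    4≢↑ˡ 0F ()
    4≢↑ˡ 1F ()
    4≢↑ˡ 2F ()

    -- There is only one spare vertex, the legs of two `out` vertices differ by number, and 4 is not
    -- a leg colour of an `out` vertex.
    leg-distinct : ∀ {u v} → ¬ Core u → ¬ Core v → u ≢ v →
                   ∀ {ℓ ℓ′} → ℓ ≢ ℓ′ → legColourOf (role u) ℓ ≢ legColourOf (role v) ℓ′
    leg-distinct {u} {v} ¬u ¬v u≢v {ℓ} {ℓ′} ℓ≢ eq with classify u | classify v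
    ... | _ , root _ | _ = ¬u root
    ... | _ , hub _  | _ = ¬u hub
    ... | _ , spare _ _ | _ , root _ = ¬v root
    ... | _ , spare _ _ | _ , hub _  = ¬v hub
    ... | _ , out _ _ | _ , root _ = ¬v root
    ... | _ , out _ _ | _ , hub _  = ¬v hub
    ... | _ , spare s p | _ , spare s′ p′ = u≢v (spare-unique s s′ p p′)
    ... | _ , out _ _ | _ , out _ _ = ℓ≢ (↑ˡ-injective (2 + m) ℓ ℓ′ eq)
    ... | _ , spare _ _ | _ , out _ _ = 4≢↑ˡ ℓ′ eq
    ... | _ , out _ _ | _ , spare _ _ = 4≢↑ˡ ℓ (sym eq)

  narrow-coloring : Σ (EdgeColoring G (5 + m)) (Is3RainbowColoring G)
  narrow-coloring = coloring , Legs.rainbow-coloring G c c-sym Core (λ v → CoreRole? (role v)) CoreColour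
    core-tree (λ v → legColourOf (role v)) leg (λ v → leg∉core (role v)) leg-distinct

-- Connected graphs without induced P₄ are joins.

P₄-copy : ∀ {n} {G : Graph n} → InducedP₄ (Graph.adj G) → InducedCopy (Path 4) G
P₄-copy {n} {G} p = record { f = f ; injective = λ {i} {j} → inj i j ; induced = induced }
  where
  open InducedP₄ p
  open Graph G using (adj; adj-sym; adj-irrefl)
  f : Fin 4 → Fin n
  f 0F = w
  f 1F = x
  f 2F = y
  f 3F = z

  table : ∀ i j → Graph.adj (Path 4) i j ≡ adj (f i) (f j)
  table 0F 0F = sym (adj-irrefl w)
  table 0F 1F = sym wx
  table 0F 2F = sym wy
  table 0F 3F = sym wz
  table 1F 0F = sym (trans (adj-sym x w) wx)
  table 1F 1F = sym (adj-irrefl x)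
  table 1F 2F = sym xy
  table 1F 3F = sym xz
  table 2F 0F = sym (trans (adj-sym y w) wy)
  table 2F 1F = sym (trans (adj-sym y x) xy)
  table 2F 2F = sym (adj-irrefl y)
  table 2F 3F = sym yz
  table 3F 0F = sym (trans (adj-sym z w) wz)
  table 3F 1F = sym (trans (adj-sym z x) xz)
  table 3F 2F = sym (trans (adj-sym z y) yz)
  table 3F 3F = sym (adj-irrefl z)

  induced : ∀ i j → Adj (Path 4) i j ⇔ Adj G (f i) (f j)
  induced i j = mk⇔ (subst T (table i j)) (subst T (sym (table i j)))

  -- No two vertices of P₄ have the same neighbourhood.
  same-row : ∀ i j → f i ≡ f j → ∀ l → Graph.adj (Path 4) i l ≡ Graph.adj (Path 4) j l
  same-row i j eq l = trans (table i l) (trans (cong (λ v → adj v (f l)) eq) (sym (table j l)))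

  inj : ∀ i j → f i ≡ f j → i ≡ j
  inj 0F 0F _ = refl
  -- The last argument of `same-row` is a column in which the two rows differ.
  inj 0F 1F eq = case same-row 0F 1F eq 0F of λ ()
  inj 0F 2F eq = case same-row 0F 2F eq 3F of λ ()
  inj 0F 3F eq = case same-row 0F 3F eq 1F of λ ()
  inj 1F 0F eq = case same-row 1F 0F eq 0F of λ ()
  inj 1F 1F _ = refl
  inj 1F 2F eq = case same-row 1F 2F eq 0F of λ ()
  inj 1F 3F eq = case same-row 1F 3F eq 0F of λ ()
  inj 2F 0F eq = case same-row 2F 0F eq 3F of λ ()
  inj 2F 1F eq = case same-row 2F 1F eq 1F of λ ()
  inj 2F 2F _ = refl
  inj 2F 3F eq = case same-row 2F 3F eq 1F of λ ()
  inj 3F 0F eq = case same-row 3F 0F eq 1F of λ ()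
  inj 3F 1F eq = case same-row 3F 1F eq 0F of λ ()
  inj 3F 2F eq = case same-row 3F 2F eq 1F of λ ()
  inj 3F 3F _ = refl

-- A split without edges across is impossible: a walk starting on the left would stay there and
-- never reach the right.
connected⇒join : ∀ {n} (G : Graph n) → 2 ≤ n → Connected G → Path 4 -Free G → Split (Graph.adj G) true
connected⇒join {suc (suc n)} G (s≤s (s≤s _)) conn free with P₄-or-Split n (Graph.adj G) (Graph.adj-sym G)
... | inj₁ p           = contradiction (P₄-copy p) free
... | inj₂ (true , s)  = s
... | inj₂ (false , s) = contradiction (trans (sym (proj₂ right)) (stays (conn _ _) (proj₂ left))) λ ()
  where
  open Split s
  stays : ∀ {u v} → Star (Adj G) u v → side u ≡ true → side v ≡ true
  stays ε su = su
  stays {u} (_◅_ {j = w} uw rest) su with side w in sw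
  ... | true  = stays rest sw
  ... | false = ⊥-elim (subst T (across u w su sw) uw)

-- Independent sets in one side of the join

module Neighbourhood {n : ℕ} (G : Graph n) (side : Fin n → Bool) where

  -- A family indexed by `Fin m` has its size in the type and directly supplies the leaves of a
  -- star.
  record Independent (m : ℕ) : Set where
    field
      i       : Fin m → Fin n
      i-side  : ∀ j → side (i j) ≡ false
      i-inj   : ∀ {j l} → i j ≡ i l → j ≡ l
      i-indep : ∀ {j l} → ¬ Adj G (i j) (i l)

  module _ {m : ℕ} (I : Independent m) where
    open Independent I

    Private : Fin m → Fin n → Set
    Private j v = side v ≡ false × Adj G v (i j) × (∀ l → Adj G v (i l) → l ≡ j)

    Private? : ∀ j v → Dec (Private j v)
    Private? j v = (side v B≟ false) ×-dec Adj? G v (i j) ×-dec all? λ l → Adj? G v (i l) →-dec (l ≟ j)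

    Private⇒≢ : ∀ {j v} → Private j v → ∀ l → v ≢ i l
    Private⇒≢ (_ , vj , _) l refl = i-indep vj

    Dominating : Set
    Dominating = ∀ v → side v ≡ false → (∃ λ j → v ≡ i j) ⊎ (∃ λ j → Adj G v (i j))

    PrivateCliques : Set
    PrivateCliques = ∀ {j u v} → Private j u → Private j v → u ≢ v → Adj G u v

    insert : ∀ v → side v ≡ false → (∀ j → v ≢ i j) → (∀ j → ¬ Adj G v (i j)) → Independent (suc m)
    insert v sv v≢ v-indep = record
      { i = i⁺ ; i-side = λ { zero → sv ; (suc j) → i-side j }
      ; i-inj = λ {j} {l} → inj j l ; i-indep = λ {j} {l} → indep j l }
      where
      i⁺ : Fin (suc m) → Fin n
      i⁺ zero    = v
      i⁺ (suc j) = i j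
      inj : ∀ j l → i⁺ j ≡ i⁺ l → j ≡ l
      inj zero    zero    _  = refl
      inj zero    (suc l) eq = contradiction eq (v≢ l)
      inj (suc j) zero    eq = contradiction (sym eq) (v≢ j)
      inj (suc j) (suc l) eq = cong suc (i-inj eq)
      indep : ∀ j l → ¬ Adj G (i⁺ j) (i⁺ l)
      indep zero    zero    = Adj-irrefl G
      indep zero    (suc l) = v-indep l
      indep (suc j) zero    = v-indep j ∘ Adj-sym G
      indep (suc j) (suc l) = i-indep

    module _ (j : Fin m) (v : Fin n) (pv : Private j v) where

      replaced : Fin m → Fin n
      replaced l with l ≟ j
      ... | yes _ = v
      ... | no  _ = i l

      -- The only neighbour of `v` in the family is `i j`, the very vertex it replaces.
      replace : Independent m
      replace = record { i = replaced ; i-side = in-side ; i-inj = λ {l} {l′} → inj l l′ ; i-indep = λ {l} {l′} → indep l l′ }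
        where
        in-side : ∀ l → side (replaced l) ≡ false
        in-side l with l ≟ j
        ... | yes _ = proj₁ pv
        ... | no  _ = i-side l
        inj : ∀ l l′ → replaced l ≡ replaced l′ → l ≡ l′
        inj l l′ eq with l ≟ j | l′ ≟ j
        ... | yes p | yes q = trans p (sym q)
        ... | yes _ | no  _ = contradiction eq (Private⇒≢ pv l′)
        ... | no  _ | yes _ = contradiction (sym eq) (Private⇒≢ pv l)
        ... | no  _ | no  _ = i-inj eq
        indep : ∀ l l′ → ¬ Adj G (replaced l) (replaced l′)
        indep l l′ e with l ≟ j | l′ ≟ j
        ... | yes _ | yes _ = Adj-irrefl G e
        ... | yes _ | no ¬q = ¬q (proj₂ (proj₂ pv) l′ e)
        ... | no ¬p | yes _ = ¬p (proj₂ (proj₂ pv) l (Adj-sym G e))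
        ... | no  _ | no  _ = i-indep e

      -- Two non-adjacent private neighbours of i j may replace i j.
      exchange : ∀ u → Private j u → u ≢ v → ¬ Adj G u v → ∀ l → u ≢ replaced l × ¬ Adj G u (replaced l)
      exchange u pu u≢v ¬uv l with l ≟ j
      ... | yes _ = u≢v , ¬uv
      ... | no ¬p = Private⇒≢ pu l , λ e → ¬p (proj₂ (proj₂ pu) l e)

  -- One step of local search: insert a vertex that has no neighbour in the family, or trade `i j`
  -- for two non-adjacent private neighbours. If neither is possible, the two wanted properties
  -- hold.
  improve : ∀ {m} (I : Independent m) → (Dominating I × PrivateCliques I) ⊎ Independent (suc m)
  improve I with any? (λ v → (side v B≟ false) ×-dec (all? λ j → ¬? (v ≟ i j)) ×-dec (all? λ j → ¬? (Adj? G v (i j))))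
    where open Independent I
  ... | yes (v , sv , v≢ , v-indep) = inj₂ (insert I v sv v≢ v-indep)
  ... | no ¬free with any? (λ j → any? λ u → any? λ v →
                      Private? I j u ×-dec Private? I j v ×-dec ¬? (u ≟ v) ×-dec ¬? (Adj? G u v))
  ...   | yes (j , u , v , pu , pv , u≢v , ¬uv) =
    inj₂ (insert (replace I j v pv) u (proj₁ pu) (proj₁ ∘ exchanged) (proj₂ ∘ exchanged))
    where exchanged = exchange I j v pv u pu u≢v ¬uv
  ...   | no ¬pair = inj₁ (dominating , λ {j} {u} {v} pu pv u≢v →
            decidable-stable (Adj? G u v) λ ¬uv → ¬pair (j , u , v , pu , pv , u≢v , ¬uv))
    where
    open Independent I
    dominating : Dominating I
    dominating v sv with any? (λ j → v ≟ i j) | any? (λ j → Adj? G v (i j))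
    ... | yes p | _     = inj₁ p
    ... | no _  | yes p = inj₂ p
    ... | no ¬p | no ¬q = contradiction (v , sv , (λ j e → ¬p (j , e)) , λ j e → ¬q (j , e)) ¬free

  module Classes {m : ℕ} (I : Independent m) (dominating : Dominating I) (cliques : PrivateCliques I) where

    open Independent I

    -- Without private neighbours the default `i j` makes the class a singleton.
    partner : Fin m → Fin n
    partner j with any? (Private? I j)
    ... | yes (v , _) = v
    ... | no  _       = i j

    partner-spec : ∀ j → partner j ≡ i j ⊎ Private I j (partner j)
    partner-spec j with any? (Private? I j)
    ... | yes (_ , p) = inj₂ p
    ... | no  _       = inj₁ refl

    partner-private : ∀ {j v} → Private I j v → Private I j (partner j)
    partner-private {j} {v} p with any? (Private? I j)
    ... | yes (_ , q) = q
    ... | no ¬q       = contradiction (v , p) ¬q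

    Member : Fin n → Fin m → Set
    Member v j = v ≡ i j ⊎ v ≡ partner j

    class-of : ∀ v → Dec (∃ (Member v))
    class-of v = any? λ j → (v ≟ i j) ⊎-dec (v ≟ partner j)

    class : Fin n → Maybe (Fin m)
    class v with class-of v
    ... | yes (j , _) = just j
    ... | no  _       = nothing

    class⁻ : ∀ {v j} → class v ≡ just j → Member v j
    class⁻ {v} eq with class-of v | eq
    ... | yes (_ , p) | refl = p

    class-nothing : ∀ {v} → class v ≡ nothing → ∀ j → ¬ Member v j
    class-nothing {v} eq j p with class-of v | eq
    ... | no ¬p | _ = ¬p (j , p)

    Hub : Fin m → Fin n → Set
    Hub = IsHub side class

    member-side : ∀ {v j} → Member v j → side v ≡ false
    member-side {j = j} (inj₁ refl) = i-side j
    member-side {j = j} (inj₂ refl) with partner-spec j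
    ... | inj₁ eq = trans (cong side eq) (i-side j)
    ... | inj₂ p  = proj₁ p

    -- The index is whichever one `class-of` finds; of a target, `Narrow` asks just that it be a hub
    -- of some class.
    member⇒hub : ∀ {v j} → Member v j → ∃ λ l → Hub l v
    member⇒hub {v} p with class-of v
    ... | yes (l , q) = l , member-side q , refl
    ... | no ¬q = contradiction (_ , p) ¬q

    i-partner : ∀ j → i j ≢ partner j → Adj G (i j) (partner j)
    i-partner j ≢ with partner-spec j
    ... | inj₁ eq = contradiction (sym eq) ≢
    ... | inj₂ p  = Adj-sym G (proj₁ (proj₂ p))

    class-adj : ∀ {j u v} → class u ≡ just j → class v ≡ just j → u ≢ v → Adj G u v
    class-adj {j} p q u≢v with class⁻ p | class⁻ q
    ... | inj₁ refl | inj₁ refl = contradiction refl u≢v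
    ... | inj₁ refl | inj₂ refl = i-partner j u≢v
    ... | inj₂ refl | inj₁ refl = Adj-sym G (i-partner j (u≢v ∘ sym))
    ... | inj₂ refl | inj₂ refl = contradiction refl u≢v

    class-size : ∀ {j u v w} → class u ≡ just j → class v ≡ just j → class w ≡ just j →
                 u ≡ v ⊎ u ≡ w ⊎ v ≡ w
    class-size p q s with class⁻ p | class⁻ q | class⁻ s
    ... | inj₁ p′ | inj₁ q′ | _       = inj₁ (trans p′ (sym q′))
    ... | inj₂ p′ | inj₂ q′ | _       = inj₁ (trans p′ (sym q′))
    ... | inj₁ p′ | inj₂ _  | inj₁ s′ = inj₂ (inj₁ (trans p′ (sym s′)))
    ... | inj₁ _  | inj₂ q′ | inj₂ s′ = inj₂ (inj₂ (trans q′ (sym s′)))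
    ... | inj₂ _  | inj₁ q′ | inj₁ s′ = inj₂ (inj₂ (trans q′ (sym s′)))
    ... | inj₂ p′ | inj₁ _  | inj₂ s′ = inj₂ (inj₁ (trans p′ (sym s′)))

    Targets : Fin n → Fin n → Fin n → Set
    Targets v t t′ = (∃ λ j → Hub j t) × (∃ λ j → Hub j t′) × Adj G t v × Adj G t′ v × t′ ≢ t

    find-targets : ∀ v → side v ≡ false → class v ≡ nothing → ∃₂ (Targets v)
    find-targets v sv cl with dominating v sv
    ... | inj₁ (j , eq) = contradiction (inj₁ eq) (class-nothing cl j)
    ... | inj₂ (j , vj) with any? (λ l → Adj? G v (i l) ×-dec ¬? (l ≟ j))
    ...   | yes (l , vl , l≢j) = i j , i l , member⇒hub (inj₁ refl) , member⇒hub (inj₁ refl) ,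
                                 Adj-sym G vj , Adj-sym G vl , l≢j ∘ i-inj
    -- With `i j` as its sole neighbour in the family, `v` is private to `j`, so `partner j` is a
    -- true private neighbour. It differs from `v`, which has no class, and the clique property
    -- makes the two adjacent.
    ...   | no ¬other = i j , partner j , member⇒hub (inj₁ refl) , member⇒hub (inj₂ refl) ,
                        Adj-sym G vj ,
                        Adj-sym G (cliques v-private pj (class-nothing cl j ∘ inj₂)) ,
                        Private⇒≢ I pj j
      where
      v-private : Private I j v
      v-private = sv , vj , λ l vl → decidable-stable (l ≟ j) λ l≢j → ¬other (l , vl , l≢j)
      pj : Private I j (partner j)
      pj = partner-private v-private

    -- `Narrow` takes the targets as total functions; vertices that have no need of targets get
    -- themselves.
    targets : ∀ v → ∃₂ λ t t′ → side v ≡ false → class v ≡ nothing → Targets v t t′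
    targets v with side v B≟ false | class v in cl
    ... | no ¬s | _       = v , v , λ s → contradiction s ¬s
    ... | yes _ | just _  = v , v , λ _ ()
    ... | yes s | nothing = let t , t′ , ok = find-targets v s cl in t , t′ , λ _ _ → ok

    -- A vertex on this side is in the family or dominated by it, so the family is non-empty.
    some-hub : ∀ v → side v ≡ false → ∃₂ Hub
    some-hub v sv with dominating v sv
    ... | inj₁ (j , _) = let l , p = member⇒hub {j = j} (inj₁ refl) in l , i j , p
    ... | inj₂ (j , _) = let l , p = member⇒hub {j = j} (inj₁ refl) in l , i j , p

  module _ (join : ∀ {u v} → side u ≡ true → side v ≡ false → Adj G u v)
           (a : Fin n) (a-side : side a ≡ true) {r : ℕ} (free : K₁ r -Free G) where

    -- Together with its common neighbour `a`, such a family is an induced star.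
    Independent-bound : ¬ Independent r
    Independent-bound I = free record { f = f ; injective = λ {j} {l} → inj j l ; induced = induced }
      where
      open Independent I
      f : Fin (suc r) → Fin n
      f zero    = a
      f (suc j) = i j
      a-i : ∀ j → Adj G a (i j)
      a-i j = join a-side (i-side j)
      inj : ∀ j l → f j ≡ f l → j ≡ l
      inj zero    zero    _  = refl
      inj zero    (suc l) eq = contradiction eq (Adj⇒≢ G (a-i l))
      inj (suc j) zero    eq = contradiction (sym eq) (Adj⇒≢ G (a-i j))
      inj (suc j) (suc l) eq = cong suc (i-inj eq)
      induced : ∀ j l → Adj (K₁ r) j l ⇔ Adj G (f j) (f l)
      induced zero    zero    = mk⇔ (λ ()) (Adj-irrefl G)
      induced zero    (suc l) = mk⇔ (λ _ → a-i l) _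
      induced (suc j) zero    = mk⇔ (λ _ → Adj-sym G (a-i j)) _
      induced (suc j) (suc l) = mk⇔ (λ ()) i-indep

    Optimal : Set
    Optimal = ∃ λ m → m < r × Σ (Independent m) λ I → Dominating I × PrivateCliques I

    -- The fuel is the distance of the size from `r`, a size that `Independent-bound` rules out.
    optimise : ∀ fuel m → fuel + m ≡ r → Independent m → Optimal
    optimise zero       m refl I = contradiction I Independent-bound
    optimise (suc fuel) m eq   I with improve I
    ... | inj₁ good = m , subst (m <_) eq (s≤s (ℕₚ.m≤n+m m fuel)) , I , good
    ... | inj₂ I⁺   = optimise fuel (suc m) (trans (ℕₚ.+-suc fuel m) eq) I⁺

    optimal : Optimal
    optimal = optimise r 0 (ℕₚ.+-identityʳ r) record { i = λ () ; i-side = λ () ; i-inj = λ { {()} } ; i-indep = λ { {()} } }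

    few-colours : (∀ {u v} → side u ≡ true → side v ≡ true → u ≢ a → v ≢ a → u ≡ v) →
      ∀ b → side b ≡ false → ∃ λ k → k ≤ 4 + r × Σ (EdgeColoring G k) (Is3RainbowColoring G)
    few-colours unique b sb =
      let m , m<r , I , dominating , cliques = optimal
          open Classes I dominating cliques
      -- Because `m < r`, one of the five extra colours is absorbed into `r`.
      in 5 + m , ℕₚ.+-monoʳ-≤ 4 m<r ,
         Narrow.narrow-coloring G side join a a-side unique class class-adj class-size
           (λ v → proj₁ (targets v)) (λ v → proj₁ (proj₂ (targets v)))
           (λ v → proj₂ (proj₂ (targets v))) (some-hub b sb)

-- Choice of the colouring and the final bound.

three-or-fewer : ∀ {n} (side : Fin n → Bool) s a → side a ≡ s →
  (∃ λ (h : Fin 3 → Fin n) → (∀ i → side (h i) ≡ s) × (∀ {i j} → h i ≡ h j → i ≡ j)) ⊎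
  (∀ {u v} → side u ≡ s → side v ≡ s → u ≢ a → v ≢ a → u ≡ v)
three-or-fewer side s a sa
  with any? (λ u → any? λ v → (side u B≟ s) ×-dec (side v B≟ s) ×-dec ¬? (u ≟ a) ×-dec ¬? (v ≟ a) ×-dec ¬? (u ≟ v))
-- This outcome is the parameter `spare-unique` of `Narrow`.
... | no none = inj₂ λ {u} {v} su sv u≢a v≢a → decidable-stable (u ≟ v) λ u≢v → none (u , v , su , sv , u≢a , v≢a , u≢v)
... | yes (u , v , su , sv , u≢a , v≢a , u≢v) = inj₁ (h , h-side , λ {i} {j} → inj i j)
  where
  h : Fin 3 → Fin _
  h 0F = a
  h 1F = u
  h 2F = v
  h-side : ∀ i → side (h i) ≡ s
  h-side 0F = sa
  h-side 1F = su
  h-side 2F = sv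
  inj : ∀ i j → h i ≡ h j → i ≡ j
  inj 0F 0F _ = refl
  inj 0F 1F eq = contradiction (sym eq) u≢a
  inj 0F 2F eq = contradiction (sym eq) v≢a
  inj 1F 0F eq = contradiction eq u≢a
  inj 1F 1F _ = refl
  inj 1F 2F eq = contradiction eq u≢v
  inj 2F 0F eq = contradiction eq v≢a
  inj 2F 1F eq = contradiction (sym eq) u≢v
  inj 2F 2F _ = refl

join⇒rainbow-coloring : ∀ {r n} → 3 ≤ r → (G : Graph n) → Split (Graph.adj G) true → K₁ r -Free G →
  ∃ λ k → k ≤ 5 + r × Σ (EdgeColoring G k) (Is3RainbowColoring G)
join⇒rainbow-coloring {r} {n} 3≤r G s free
  with three-or-fewer side true (proj₁ left) (proj₂ left) | three-or-fewer side false (proj₁ right) (proj₂ right)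
  where open Split s
... | inj₂ fewer | _ =
  let k , k≤ , c = Neighbourhood.few-colours G side joined (proj₁ left) (proj₂ left) free fewer (proj₁ right) (proj₂ right)
  in k , ℕₚ.m≤n⇒m≤1+n k≤ , c
  where
  open Split s
  joined : ∀ {u v} → side u ≡ true → side v ≡ false → Adj G u v
  joined su sv = subst T (sym (across _ _ su sv)) _
... | inj₁ _ | inj₂ fewer =
  -- The right side is the small one, so negation exchanges the sides.
  let k , k≤ , c = Neighbourhood.few-colours G (not ∘ side) joined (proj₁ right) (cong not (proj₂ right)) free
                     (λ su sv → fewer (not-≡ su) (not-≡ sv)) (proj₁ left) (cong not (proj₂ left))
  in k , ℕₚ.m≤n⇒m≤1+n k≤ , c
  where
  open Split s
  joined : ∀ {u v} → not (side u) ≡ true → not (side v) ≡ false → Adj G u v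
  joined su sv = Adj-sym G (subst T (sym (across _ _ (not-≡ sv) (not-≡ su))) _)
... | inj₁ (h , h-side , h-inj) | inj₁ (h′ , h′-side , h′-inj) =
  -- This case uses `3 ≤ r`, to fit eight colours into `5 + r`.
  8 , ℕₚ.+-monoʳ-≤ 5 3≤r , Wide.wide-coloring G side (λ su sv → subst T (sym (across _ _ su sv)) _)
    (λ { true → h ; false → h′ }) (λ { true → h-side ; false → h′-side }) (λ { true → h-inj ; false → h′-inj })
  where open Split s

theorem7 : ∀ (r : ℕ) → 3 ≤ r → ∀ (n : ℕ) → 3 ≤ n → (G : Graph n) →
    Connected G → Path 4 -Free G → K₁ r -Free G →
    ∀ (k d : ℕ) → IsRx₃ G k → IsSdiam₃ G d → k ≤ d + r + 3
-- A triple attaining the Steiner diameter comes with a tree of `d` edges. By `STree-size` it has at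
-- least two, which turns `2 + r + 3` into the bound.
theorem7 r 3≤r n 3≤n G conn P₄-free K-free k d (_ , minimal)
  ((S , ∣S∣ , (H , H-tree , refl) , _) , _) = begin
    k         ≤⟨ minimal k′ coloring ⟩
    k′        ≤⟨ k′≤ ⟩
    5 + r     ≡⟨ cong (2 +_) (ℕₚ.+-comm 3 r) ⟩
    2 + r + 3 ≤⟨ ℕₚ.+-monoˡ-≤ 3 (ℕₚ.+-monoˡ-≤ r (STree-size H ∣S∣ H-tree)) ⟩
    d + r + 3 ∎
  where
  open ℕₚ.≤-Reasoning
  found = join⇒rainbow-coloring 3≤r G (connected⇒join G (ℕₚ.≤-trans (ℕₚ.n≤1+n 2) 3≤n) conn P₄-free) K-free
  k′ = proj₁ found
  k′≤ = proj₁ (proj₂ found)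
  coloring = proj₂ (proj₂ found)
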